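{- Let $P(t)=a_0+a_1t+\cdots+a_dt^d$ be a polynomial with real coefficients such that $P(0)=a_0=1$ and $a_0,a_1,\ldots,a_d$ are all positive, and let $F_P(\mathbf{x})=\prod_{i\ge 1}P(x_i)$, where $\mathbf{x}=\{x_1,x_2,\ldots\}$ is a countably infinite set of indeterminates. Then the following conditions are equivalent: (i) The coefficient of the Schur function $s_\lambda(\mathbf{x})$ in $F_P(\mathbf{x})$ is nonnegative for every integer partition $\lambda$ of length at most $2$. (ii) The coefficient of $s_{(k,k)}(\mathbf{x})$ in $F_P(\mathbf{x})$ is nonnegative for every $k\ge 1$. (iii) $P(t)$ is log-concave. (iv) $P(t)$ is strongly log-concave.
   Context: The product $F_P(\mathbf{x})$ is an inhomogeneous symmetric formal power series, possibly of unbounded degree; each of its homogeneous components is a symmetric function, and the coefficient of $s_\lambda$ in $F_P$ means the coefficient of $s_\lambda$ in the Schur-basis expansion of the homogeneous component of degree $|\lambda|$. The length $\ell(\lambda)$ of a partition is its number of (nonzero) parts. A polynomial $a_0+a_1t+\cdots+a_dt^d$ is log-concave if $a_j^2\ge a_{j-1}a_{j+1}$ for all $1\le j\le d-1$. It is strongly log-concave if $a_ma_n\ge a_pa_q$ for all integers $0\le p<m\le n<q\le d$ with $m+n=p+q$. -}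

module Defs where

open import Data.Bool.Base using (if_then_else_)
open import Data.Fin.Base as Fin using (Fin; toℕ; fromℕ<)
open import Data.Integer.Base using (+_)
open import Data.List.Base
  using (List; []; _∷_; map; foldr; concat; concatMap; filter; length; replicate;
         upTo; cartesianProductWith)
open import Data.List.Properties using (≡-dec)
open import Data.List.Relation.Binary.Prefix.Heterogeneous using (Prefix)
open import Data.List.Relation.Binary.Prefix.Heterogeneous.Properties using (prefix?)
open import Data.List.Relation.Unary.All using (All; all?)
open import Data.List.Relation.Unary.Linked using (Linked; linked?)
open import Data.Nat.Base as ℕ using (ℕ; zero; suc; _∸_)
open import Data.Nat.ListAction using (sum)
import Data.Nat.Properties as ℕₚ
open import Data.Product.Base using (Σ; ∃; ∃-syntax; _×_; _,_; proj₁; proj₂)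
open import Data.Rational.Base as ℚ
  using (ℚ; 0ℚ; 1ℚ; ½; _+_; _*_; _-_; -_; ∣_∣; _<_; _≤_; 1/_; Positive; positive)
import Data.Rational.Properties as ℚₚ
open import Data.Rational.Solver using (module +-*-Solver)
open import Relation.Binary.PropositionalEquality
  using (_≡_; refl; sym; trans; cong; cong₂; subst)
open import Relation.Nullary.Decidable using (Dec; yes; no; does; _×-dec_)
open import Relation.Unary using (Decidable)

-- Real numbers are Cauchy sequences of rationals, with _≈ᵣ_ as equality.

Cauchy : (ℕ → ℚ) → Set
Cauchy x = ∀ ε → 0ℚ < ε →
  ∃[ N ] (∀ m n → N ℕ.≤ m → N ℕ.≤ n → ∣ x m - x n ∣ < ε)

record ℝ : Set where
  constructor mkℝ
  field
    seq    : ℕ → ℚ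
    cauchy : Cauchy seq

open ℝ public

infix 4 _≈ᵣ_ _<ᵣ_ _≤ᵣ_

_≈ᵣ_ : ℝ → ℝ → Set
x ≈ᵣ y = ∀ ε → 0ℚ < ε → ∃[ N ] (∀ n → N ℕ.≤ n → ∣ seq x n - seq y n ∣ < ε)

_<ᵣ_ : ℝ → ℝ → Set
x <ᵣ y = ∃[ ε ] (0ℚ < ε × ∃[ N ] (∀ n → N ℕ.≤ n → seq x n + ε < seq y n))

_≤ᵣ_ : ℝ → ℝ → Set
x ≤ᵣ y = ∀ ε → 0ℚ < ε → ∃[ N ] (∀ n → N ℕ.≤ n → seq x n < seq y n + ε)

fromℚ : ℚ → ℝ
fromℚ q = mkℝ (λ _ → q) λ ε 0<ε → 0 , λ _ _ _ _ →
  subst (_< ε) (cong ∣_∣ (sym (ℚₚ.+-inverseʳ q))) 0<ε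

0ℝ 1ℝ : ℝ
0ℝ = fromℚ 0ℚ
1ℝ = fromℚ 1ℚ

fromℕ : ℕ → ℝ
fromℕ n = fromℚ (+ n ℚ./ 1)

private
  open +-*-Solver using (solve; _:+_; _:*_; _:-_; _:=_)

  swap : ∀ b h c → b * (h * c) ≡ h * (b * c)
  swap = solve 3 (λ b h c → b :* (h :* c) := h :* (b :* c)) refl

  cancel : ∀ p q → (p - q) + q ≡ p
  cancel = solve 2 (λ p q → (p :- q) :+ q := p) refl

  +-diff : ∀ a b c d → (a - b) + (c - d) ≡ (a + c) - (b + d)
  +-diff = solve 4 (λ a b c d → (a :- b) :+ (c :- d) := (a :+ c) :- (b :+ d)) refl

  *-diff : ∀ a b c d → a * (c - d) + d * (a - b) ≡ a * c - b * d
  *-diff = solve 4 (λ a b c d → a :* (c :- d) :+ d :* (a :- b) := a :* c :- b :* d) refl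

  shrink : ∀ B ε → 0ℚ < B → 0ℚ < ε → ∃[ δ ] (0ℚ < δ × B * δ ≡ ½ * ε)
  shrink B ε 0<B 0<ε = ½ * ε * B⁻¹ , 0<δ , eq
    where
    instance
      B-pos : Positive B
      B-pos = positive 0<B
      ε-pos : Positive ε
      ε-pos = positive 0<ε
      B-nz : ℚ.NonZero B
      B-nz = ℚₚ.pos⇒nonZero B

    B⁻¹ : ℚ
    B⁻¹ = 1/ B

    0<δ : 0ℚ < ½ * ε * B⁻¹
    0<δ = ℚₚ.positive⁻¹ _
      {{ℚₚ.pos*pos⇒pos (½ * ε) {{ℚₚ.pos*pos⇒pos ½ ε}} B⁻¹ {{ℚₚ.1/pos⇒pos B}}}}

    eq : B * (½ * ε * B⁻¹) ≡ ½ * ε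
    eq = trans (swap B (½ * ε) B⁻¹)
      (trans (cong (½ * ε *_) (ℚₚ.*-inverseʳ B)) (ℚₚ.*-identityʳ (½ * ε)))

  halves : ∀ ε → ½ * ε + ½ * ε ≡ ε
  halves ε = trans (sym (ℚₚ.*-distribʳ-+ ε ½ ½)) (ℚₚ.*-identityˡ ε)

  half-pos : ∀ ε → 0ℚ < ε → 0ℚ < ½ * ε
  half-pos ε 0<ε = ℚₚ.positive⁻¹ _ {{ℚₚ.pos*pos⇒pos ½ ε {{positive 0<ε}}}}

  ∣+∣-bound : ∀ p q ε → ∣ p ∣ < ½ * ε → ∣ q ∣ < ½ * ε → ∣ p + q ∣ < ε
  ∣+∣-bound p q ε p< q< = ℚₚ.≤-<-trans (ℚₚ.∣p+q∣≤∣p∣+∣q∣ p q)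
    (subst (∣ p ∣ + ∣ q ∣ <_) (halves ε) (ℚₚ.+-mono-< p< q<))

  ∣*∣-bound : ∀ p q B δ → 0ℚ < B → ∣ p ∣ < B → ∣ q ∣ < δ → ∣ p * q ∣ < B * δ
  ∣*∣-bound p q B δ 0<B p< q< = subst (_< B * δ) (sym (ℚₚ.∣p*q∣≡∣p∣*∣q∣ p q))
    (ℚₚ.≤-<-trans
      (ℚₚ.*-monoʳ-≤-nonNeg ∣ q ∣ {{ℚ.nonNegative (ℚₚ.0≤∣p∣ q)}} (ℚₚ.<⇒≤ p<))
      (ℚₚ.*-monoʳ-<-pos B {{positive 0<B}} q<))

  eventually-bounded : ∀ x → Cauchy x →
    ∃[ B ] (0ℚ < B × ∃[ N ] (∀ n → N ℕ.≤ n → ∣ x n ∣ < B))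
  eventually-bounded x cx with cx 1ℚ (ℚₚ.positive⁻¹ 1ℚ)
  ... | N , h = 1ℚ + ∣ x N ∣
    , ℚₚ.+-mono-<-≤ (ℚₚ.positive⁻¹ 1ℚ) (ℚₚ.0≤∣p∣ (x N))
    , N , λ n N≤n → ℚₚ.≤-<-trans
        (subst (λ z → ∣ z ∣ ≤ ∣ x n - x N ∣ + ∣ x N ∣)
          (cancel (x n) (x N))
          (ℚₚ.∣p+q∣≤∣p∣+∣q∣ (x n - x N) (x N)))
        (ℚₚ.+-mono-<-≤ (h n N N≤n ℕₚ.≤-refl) ℚₚ.≤-refl)

  +-cauchy : ∀ x y → Cauchy x → Cauchy y → Cauchy (λ n → x n + y n)
  +-cauchy x y cx cy ε 0<ε
    with cx (½ * ε) (half-pos ε 0<ε) | cy (½ * ε) (half-pos ε 0<ε)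
  ... | M , hx | N , hy = M ℕ.⊔ N , λ m n p q →
    subst (λ z → ∣ z ∣ < ε) (+-diff (x m) (x n) (y m) (y n))
      (∣+∣-bound (x m - x n) (y m - y n) ε
        (hx m n (ℕₚ.m⊔n≤o⇒m≤o M N p) (ℕₚ.m⊔n≤o⇒m≤o M N q))
        (hy m n (ℕₚ.m⊔n≤o⇒n≤o M N p) (ℕₚ.m⊔n≤o⇒n≤o M N q)))

  ∣*-diff∣-bound : ∀ a b c d B C δ η ε → 0ℚ < B → 0ℚ < C →
    B * δ ≡ ½ * ε → C * η ≡ ½ * ε →
    ∣ a ∣ < B → ∣ d ∣ < C → ∣ c - d ∣ < δ → ∣ a - b ∣ < η → ∣ a * c - b * d ∣ < ε
  ∣*-diff∣-bound a b c d B C δ η ε 0<B 0<C Bδ Cη a< d< c-d< a-b< =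
    subst (λ z → ∣ z ∣ < ε) (*-diff a b c d)
      (∣+∣-bound (a * (c - d)) (d * (a - b)) ε
        (subst (∣ a * (c - d) ∣ <_) Bδ (∣*∣-bound a (c - d) B δ 0<B a< c-d<))
        (subst (∣ d * (a - b) ∣ <_) Cη (∣*∣-bound d (a - b) C η 0<C d< a-b<)))

  *-cauchy : ∀ x y → Cauchy x → Cauchy y → Cauchy (λ n → x n * y n)
  *-cauchy x y cx cy ε 0<ε =
    let B , 0<B , K , bx = eventually-bounded x cx
        C , 0<C , L , by = eventually-bounded y cy
        δ , 0<δ , Bδ     = shrink B ε 0<B 0<ε
        η , 0<η , Cη     = shrink C ε 0<C 0<ε
    in  go B C δ η 0<B 0<C Bδ Cη K L bx by (cy δ 0<δ) (cx η 0<η)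
    where
    go : ∀ B C δ η → 0ℚ < B → 0ℚ < C → B * δ ≡ ½ * ε → C * η ≡ ½ * ε → ∀ K L →
      (∀ n → K ℕ.≤ n → ∣ x n ∣ < B) → (∀ n → L ℕ.≤ n → ∣ y n ∣ < C) →
      ∃[ M ] (∀ m n → M ℕ.≤ m → M ℕ.≤ n → ∣ y m - y n ∣ < δ) →
      ∃[ N ] (∀ m n → N ℕ.≤ m → N ℕ.≤ n → ∣ x m - x n ∣ < η) →
      ∃[ R ] (∀ m n → R ℕ.≤ m → R ℕ.≤ n → ∣ x m * y m - x n * y n ∣ < ε)
    go B C δ η 0<B 0<C Bδ Cη K L bx by (M , hy) (N , hx) =
      (K ℕ.⊔ L) ℕ.⊔ (M ℕ.⊔ N) , λ m n p q →
      let KL≤m = ℕₚ.m⊔n≤o⇒m≤o (K ℕ.⊔ L) (M ℕ.⊔ N) p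
          MN≤m = ℕₚ.m⊔n≤o⇒n≤o (K ℕ.⊔ L) (M ℕ.⊔ N) p
          KL≤n = ℕₚ.m⊔n≤o⇒m≤o (K ℕ.⊔ L) (M ℕ.⊔ N) q
          MN≤n = ℕₚ.m⊔n≤o⇒n≤o (K ℕ.⊔ L) (M ℕ.⊔ N) q
      in
      ∣*-diff∣-bound (x m) (x n) (y m) (y n) B C δ η ε 0<B 0<C Bδ Cη
        (bx m (ℕₚ.m⊔n≤o⇒m≤o K L KL≤m)) (by n (ℕₚ.m⊔n≤o⇒n≤o K L KL≤n))
        (hy m n (ℕₚ.m⊔n≤o⇒m≤o M N MN≤m) (ℕₚ.m⊔n≤o⇒m≤o M N MN≤n))
        (hx m n (ℕₚ.m⊔n≤o⇒n≤o M N MN≤m) (ℕₚ.m⊔n≤o⇒n≤o M N MN≤n))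

infixl 6 _+ᵣ_
infixl 7 _*ᵣ_

_+ᵣ_ : ℝ → ℝ → ℝ
x +ᵣ y = mkℝ (λ n → seq x n + seq y n) (+-cauchy (seq x) (seq y) (cauchy x) (cauchy y))

_*ᵣ_ : ℝ → ℝ → ℝ
x *ᵣ y = mkℝ (λ n → seq x n * seq y n) (*-cauchy (seq x) (seq y) (cauchy x) (cauchy y))

Σᵣ : {A : Set} → List A → (A → ℝ) → ℝ
Σᵣ xs f = foldr (λ x s → f x +ᵣ s) 0ℝ xs

-- a₀ + a₁ t + ⋯ + a_d t^d, given by its coefficients.
Poly : ℕ → Set
Poly d = Fin (suc d) → ℝ

coeff : ∀ {d} → Poly d → ℕ → ℝ
coeff {d} a j with j ℕₚ.<? suc d
... | yes j≤d = a (fromℕ< j≤d)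
... | no  _   = 0ℝ

-- The three indices i, j, k are j-1, j, j+1 with 1 ≤ j ≤ d-1.
LogConcave : ∀ {d} → Poly d → Set
LogConcave {d} a = (i j k : Fin (suc d)) →
  toℕ j ≡ suc (toℕ i) → toℕ k ≡ suc (toℕ j) →
  a i *ᵣ a k ≤ᵣ a j *ᵣ a j

StronglyLogConcave : ∀ {d} → Poly d → Set
StronglyLogConcave {d} a = (p m n q : Fin (suc d)) →
  p Fin.< m → m Fin.≤ n → n Fin.< q → toℕ m ℕ.+ toℕ n ≡ toℕ p ℕ.+ toℕ q →
  a p *ᵣ a q ≤ᵣ a m *ᵣ a n

-- Variables are x₀, x₁, x₂, …, and α₀ ∷ ⋯ ∷ α_{k-1} ∷ [] stands for the monomial
-- x₀^α₀ ⋯ x_{k-1}^α_{k-1}.  Lists differing only by trailing zeros stand for the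
-- same monomial; the series below (for F: when P(0) = 1) agree on them.
Monomial : Set
Monomial = List ℕ

degree : Monomial → ℕ
degree = sum

IsOne : Monomial → Set
IsOne = All (_≡ 0)

isOne? : Decidable IsOne
isOne? = all? (ℕₚ._≟ 0)

Series : Set
Series = Monomial → ℝ

infix 4 _≋_
_≋_ : Series → Series → Set
f ≋ g = ∀ α → f α ≈ᵣ g α

-- All pairs (β , γ) with x^β · x^γ = x^α.
factorisations : Monomial → List (Monomial × Monomial)
factorisations []      = ([] , []) ∷ []
factorisations (n ∷ α) =
  cartesianProductWith (λ i (β , γ) → (i ∷ β , (n ∸ i) ∷ γ))
    (upTo (suc n)) (factorisations α)

oneₛ : Series
oneₛ α = if does (isOne? α) then 1ℝ else 0ℝ

infixl 7 _*ₛ_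
_*ₛ_ : Series → Series → Series
(f *ₛ g) α = Σᵣ (factorisations α) λ (β , γ) → f β *ᵣ g γ

-- The series P(xᵢ).
at : ∀ {d} → Poly d → ℕ → Series
at a i       []          = coeff a 0
at a zero    (n ∷ α)     = if does (isOne? α) then coeff a n else 0ℝ
at a (suc i) (zero ∷ α)  = at a i α
at a (suc i) (suc _ ∷ α) = 0ℝ

-- P(x₀) P(x₁) ⋯ P(x_{N-1})
partialProduct : ∀ {d} → Poly d → ℕ → Series
partialProduct a zero    = oneₛ
partialProduct a (suc N) = partialProduct a N *ₛ at a N

-- The infinite product ∏ᵢ P(xᵢ), when P(0) = 1: the factors P(xᵢ) with
-- i ≥ length α do not affect the coefficient of x^α, so that coefficient is
-- the eventual value of the coefficient in the partial products.
F : ∀ {d} → Poly d → Series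
F a α = partialProduct a (length α) α

homogeneous : ℕ → Series → Series
homogeneous n f α = if does (degree α ℕₚ.≟ n) then f α else 0ℝ

-- Lists of nonzero parts, so that ℓ(ν) = length ν.
IsPartition : List ℕ → Set
IsPartition ν = Linked ℕ._≥_ ν × All (0 ℕ.<_) ν

isPartition? : Decidable IsPartition
isPartition? ν = linked? ℕₚ._≥?_ ν ×-dec all? (0 ℕₚ.<?_) ν

choices : {A : Set} → List (List A) → List (List A)
choices []         = [] ∷ []
choices (xs ∷ xss) = cartesianProductWith _∷_ xs (choices xss)

-- All lists of length r with entries in {0, …, k-1}.
words : ℕ → ℕ → List (List ℕ)
words k r = choices (replicate r (upTo k))

partitions : ℕ → List (List ℕ)
partitions n = filter (λ ν → isPartition? ν ×-dec (sum ν ℕₚ.≟ n))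
  (concatMap (words (suc n)) (upTo (suc n)))

-- A tableau is the list of its rows, from top to bottom; the entry i
-- corresponds to the variable xᵢ.
Tableau : Set
Tableau = List (List ℕ)

-- All fillings of the diagram of ν by {0, …, k-1}.
fillings : ℕ → List ℕ → List Tableau
fillings k ν = choices (map (words k) ν)

-- Rows weakly increase, and each entry exceeds the one directly above it.
Semistandard : Tableau → Set
Semistandard T =
  All (Linked ℕ._≤_) T × Linked (λ upper lower → Prefix ℕ._>_ lower upper) T

semistandard? : Decidable Semistandard
semistandard? T =
  all? (linked? ℕₚ._≤?_) T ×-dec linked? (λ upper lower → prefix? ℕₚ._>?_ lower upper) T

occurrences : ℕ → Tableau → ℕ
occurrences i T = length (filter (i ℕₚ.≟_) (concat T))

-- The monomial x^T, for T with entries in {0, …, k-1}.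
content : ℕ → Tableau → Monomial
content k T = map (λ i → occurrences i T) (upTo k)

-- s_ν = Σ_T x^T over the semistandard tableaux T of shape ν.  A tableau with
-- x^T = x^α has all its entries below length α.
schur : List ℕ → Series
schur ν α = fromℕ (length (filter
  (λ T → semistandard? T ×-dec ≡-dec ℕₚ._≟_ (content (length α) T) α)
  (fillings (length α) ν)))

-- c ν is the coefficient of s_ν in f, for every partition ν; the values of c
-- on other lists play no role.
IsSchurExpansion : Series → (List ℕ → ℝ) → Set
IsSchurExpansion f c = ∀ n →
  homogeneous n f ≋ λ α → Σᵣ (partitions n) λ ν → c ν *ᵣ schur ν α

{-# OPTIONS --safe #-}

-- The monomials in two variables determine the coefficients c(λ) of the s_λ with ℓ(λ) ≤ 2.
-- For m ≥ n the coefficient of x₀^m x₁^n in s_(p,q) is 1 if q ≤ n and 0 otherwise, so the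
-- coefficients a_m a_n of F_P give a_m a_n = Σ_{q ≤ n} c(m+n-q, q), and by subtraction
-- c(m, n+1) = a_m a_{n+1} - a_{m+1} a_n.  Log-concavity with positive coefficients says that
-- the ratios a_j / a_{j+1} increase, which makes all these differences nonnegative.

module Submission where

open import Defs
open import Data.Fin.Base using (Fin; zero; suc)
open import Data.List.Base using (List; []; _∷_; length)
open import Data.Nat.Base using (ℕ; suc; _≤_)
open import Data.Product.Base using (_×_)
open import Function.Bundles using (_⇔_)

open import Data.Bool.Base using (if_then_else_)
open import Data.Empty using (⊥-elim)
import Data.Fin.Base as Fin
import Data.Fin.Properties as Finₚ
import Data.Integer.Base as ℤ
open import Data.List.Base using (_++_; map; concat; concatMap; filter; replicate; upTo)
open import Data.List.Membership.Propositional using (_∈_)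
open import Data.List.Membership.Propositional.Properties
  using (∈-cartesianProductWith⁺; ∈-cartesianProductWith⁻; ∈-concat⁺′;
         ∈-filter⁺; ∈-filter⁻; ∈-map⁺; ∈-upTo⁺; ∈-upTo⁻)
open import Data.List.Properties
  using (filter-++; filter-all; filter-none; length-++; length-replicate;
         ∷-injective; ∷-injectiveˡ; ∷-injectiveʳ; ≡-dec)
open import Data.List.Relation.Binary.Disjoint.Propositional using (Disjoint)
open import Data.List.Relation.Binary.Pointwise.Base using (Pointwise; []; _∷_)
open import Data.List.Relation.Binary.Prefix.Heterogeneous using (Prefix; []; _∷_)
open import Data.List.Relation.Unary.All as All using (All; []; _∷_)
import Data.List.Relation.Unary.All.Properties as Allₚ
open import Data.List.Relation.Unary.AllPairs as AllPairs using ([]; _∷_)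
import Data.List.Relation.Unary.AllPairs.Properties as AllPairsₚ
open import Data.List.Relation.Unary.Any using (here; there)
open import Data.List.Relation.Unary.Linked as Linked using (Linked; []; [-]; _∷_)
open import Data.List.Relation.Unary.Unique.Propositional using (Unique)
import Data.List.Relation.Unary.Unique.Propositional.Properties as Uniqueₚ
open import Data.Nat.Base as ℕ using (zero; _∸_; z≤n; s≤s)
open import Data.Nat.ListAction using (sum)
import Data.Nat.Properties as ℕₚ
open import Data.Product.Base using (∃-syntax; _,_; proj₁; proj₂)
open import Data.Rational.Base as ℚ using (ℚ; 0ℚ; 1ℚ; ½; _+_; _*_; _-_; -_; _<_; 1/_)
import Data.Rational.Properties as ℚₚ
open import Data.Rational.Solver using (module +-*-Solver)
open import Data.Sum.Base using (inj₁; inj₂)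
open import Function.Base using (_∘_)
open import Function.Bundles using (mk⇔)
open import Relation.Binary.Definitions using (tri<; tri≈; tri>)
open import Relation.Binary.PropositionalEquality
import Relation.Binary.Reasoning.Base.Single as Single
open import Relation.Nullary.Decidable using (yes; no; _×-dec_; dec-true; dec-false)
open import Relation.Nullary.Negation using (¬_)
open import Relation.Unary using (Decidable)

open +-*-Solver using (solve; _:+_; _:*_; _:-_; :-_; _:=_)

-- The subtraction isolates one unknown because the tableau counts for x₀^m x₁^(n+1) and x₀^(m+1)
-- x₁^n agree on every partition of m+n+1 other than (m, n+1). For m = n+1 the resulting inequality
-- is log-concavity at the index m, so the square partitions (k, k) already carry all of (iii). The
-- way back to arbitrary (m, n+1) is the chain of ratio comparisons. The obstacle is the real
-- numbers: equality is `≈ᵣ`, the order holds only eventually and up to ε, and neither subtraction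
-- nor division is at hand. A difference is therefore kept in the form x ≤ x + y, a comparison of
-- ratios is an inequality of products followed by cancellation of a positive factor, and ring
-- identities are verified on the k-th terms of the sequences. A second point is the degree:
-- partitions have parts of any size while a_j stops at j = d, so the inequalities between products
-- must be continued by zero coefficients.

private variable
  x y z : ℝ

-- Order and multiplication of real numbers

infix 4 _≗ᵣ_ _≼_

-- All algebraic identities between the reals below already hold term by term.
_≗ᵣ_ : ℝ → ℝ → Set
x ≗ᵣ y = ∀ k → seq x k ≡ seq y k

Eventually : (ℕ → Set) → Set
Eventually P = ∃[ N ] (∀ n → N ≤ n → P n)

lift₁ : ∀ {P Q : ℕ → Set} → (∀ n → P n → Q n) → Eventually P → Eventually Q
lift₁ f (N , p) = N , λ n N≤n → f n (p n N≤n)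

lift₂ : ∀ {P Q R : ℕ → Set} → (∀ n → P n → Q n → R n) →
  Eventually P → Eventually Q → Eventually R
lift₂ f (M , p) (N , q) = M ℕ.⊔ N , λ n M⊔N≤n →
  f n (p n (ℕₚ.m⊔n≤o⇒m≤o M N M⊔N≤n)) (q n (ℕₚ.m⊔n≤o⇒n≤o M N M⊔N≤n))

-- Stronger than `0ℝ ≼ x`, which allows every term to be slightly negative. A sign for the terms is
-- what allows inequalities to be multiplied term by term; strictly positive reals and `0ℝ` have it.
EventuallyNonNeg : ℝ → Set
EventuallyNonNeg x = Eventually λ n → 0ℚ ℚ.≤ seq x n

p<p+ε : ∀ p {ε} → 0ℚ < ε → p < p + ε
p<p+ε p {ε} 0<ε = subst (_< p + ε) (ℚₚ.+-identityʳ p) (ℚₚ.+-monoʳ-< p 0<ε)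

halves : ∀ p ε → (p + ½ * ε) + ½ * ε ≡ p + ε
halves p ε = trans (ℚₚ.+-assoc p (½ * ε) (½ * ε))
  (cong (p +_) (trans (sym (ℚₚ.*-distribʳ-+ ε ½ ½)) (ℚₚ.*-identityˡ ε)))

½*-pos : ∀ {ε} → 0ℚ < ε → 0ℚ < ½ * ε
½*-pos {ε} 0<ε = ℚₚ.positive⁻¹ _ {{ℚₚ.pos*pos⇒pos ½ ε {{ℚ.positive 0<ε}}}}

*-pos : ∀ {p q} → 0ℚ < p → 0ℚ < q → 0ℚ < p * q
*-pos {p} {q} 0<p 0<q =
  ℚₚ.positive⁻¹ _ {{ℚₚ.pos*pos⇒pos p {{ℚ.positive 0<p}} q {{ℚ.positive 0<q}}}}

p-q<ε⇒p<q+ε : ∀ p q {ε} → p - q < ε → p < q + ε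
p-q<ε⇒p<q+ε p q {ε} p-q<ε = subst (_< q + ε)
  (solve 2 (λ p q → q :+ (p :- q) := p) refl p q) (ℚₚ.+-monoʳ-< q p-q<ε)

p≤∣p∣ : ∀ p → p ℚ.≤ ℚ.∣ p ∣
p≤∣p∣ p with ℚₚ.≤-total 0ℚ p
... | inj₁ 0≤p = ℚₚ.≤-reflexive (sym (ℚₚ.0≤p⇒∣p∣≡p 0≤p))
... | inj₂ p≤0 = ℚₚ.≤-trans p≤0 (ℚₚ.0≤∣p∣ p)

-- A record, so that x and y can be inferred from a proof of x ≼ y.
record _≼_ (x y : ℝ) : Set where
  constructor from-≤ᵣ
  field to-≤ᵣ : x ≤ᵣ y

open _≼_

eventually-≤⇒≼ : Eventually (λ n → seq x n ℚ.≤ seq y n) → x ≼ y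
eventually-≤⇒≼ {y = y} x≤y .to-≤ᵣ ε 0<ε =
  lift₁ (λ n x≤y → ℚₚ.≤-<-trans x≤y (p<p+ε (seq y n) 0<ε)) x≤y

≗⇒≼ : x ≗ᵣ y → x ≼ y
≗⇒≼ x≗y = eventually-≤⇒≼ (0 , λ n _ → ℚₚ.≤-reflexive (x≗y n))

nonNeg⇒≽0 : EventuallyNonNeg x → 0ℝ ≼ x
nonNeg⇒≽0 = eventually-≤⇒≼

≈⇒≼ : ∀ x y → x ≈ᵣ y → x ≼ y
≈⇒≼ x y x≈y .to-≤ᵣ ε 0<ε = lift₁
  (λ n ∣x-y∣<ε → p-q<ε⇒p<q+ε (seq x n) (seq y n) (ℚₚ.≤-<-trans (p≤∣p∣ _) ∣x-y∣<ε))
  (x≈y ε 0<ε)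

≈-sym : ∀ x y → x ≈ᵣ y → y ≈ᵣ x
≈-sym x y x≈y ε 0<ε = lift₁
  (λ n → subst (_< ε) (trans (sym (ℚₚ.∣-p∣≡∣p∣ (seq x n - seq y n)))
    (cong ℚ.∣_∣ (negate (seq x n) (seq y n)))))
  (x≈y ε 0<ε)
  where
  negate : ∀ p q → - (p - q) ≡ q - p
  negate = solve 2 (λ p q → :- (p :- q) := q :- p) refl

≼-trans : x ≼ y → y ≼ z → x ≼ z
≼-trans {z = z} x≼y y≼z .to-≤ᵣ ε 0<ε = lift₂
  (λ n x<y+ε/2 y<z+ε/2 → subst (_ <_) (halves (seq z n) ε)
    (ℚₚ.<-trans x<y+ε/2 (ℚₚ.+-monoˡ-< (½ * ε) y<z+ε/2)))
  (to-≤ᵣ x≼y (½ * ε) (½*-pos 0<ε)) (to-≤ᵣ y≼z (½ * ε) (½*-pos 0<ε))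

-- With `0≼y⇒x≼x+y` this stands in for subtraction of reals: y plays the difference of x + y and x.
x≼x+y⇒0≼y : x ≼ x +ᵣ y → 0ℝ ≼ y
x≼x+y⇒0≼y {x} {y} x≼x+y .to-≤ᵣ ε 0<ε = lift₁
  (λ n p<p+q+ε → subst₂ _<_ (ℚₚ.+-inverseˡ (seq x n)) (cancel (seq x n) (seq y n) ε)
    (ℚₚ.+-monoʳ-< (- seq x n) p<p+q+ε))
  (to-≤ᵣ x≼x+y ε 0<ε)
  where
  cancel : ∀ p q ε → - p + (p + q + ε) ≡ q + ε
  cancel = solve 3 (λ p q ε → (:- p) :+ (p :+ q :+ ε) := q :+ ε) refl

0≼y⇒x≼x+y : 0ℝ ≼ y → x ≼ x +ᵣ y
0≼y⇒x≼x+y {y} {x} 0≼y .to-≤ᵣ ε 0<ε = lift₁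
  (λ n 0<q+ε → subst₂ _<_ (ℚₚ.+-identityʳ (seq x n)) (sym (ℚₚ.+-assoc (seq x n) (seq y n) ε))
    (ℚₚ.+-monoʳ-< (seq x n) 0<q+ε))
  (to-≤ᵣ 0≼y ε 0<ε)

<ᵣ⇒nonNeg : ∀ x → 0ℝ <ᵣ x → EventuallyNonNeg x
<ᵣ⇒nonNeg x (ε , 0<ε , N , ε<x) = N , λ n N≤n →
  ℚₚ.<⇒≤ (ℚₚ.<-trans (subst (0ℚ <_) (sym (ℚₚ.+-identityˡ ε)) 0<ε) (ε<x n N≤n))

eventually-bounded : ∀ x → ∃[ B ] (0ℚ < B × Eventually λ n → seq x n < B)
eventually-bounded x with cauchy x 1ℚ (ℚₚ.positive⁻¹ 1ℚ)
... | N , close = ℚ.∣ seq x N ∣ + 1ℚ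
  , ℚₚ.+-mono-≤-< (ℚₚ.0≤∣p∣ (seq x N)) (ℚₚ.positive⁻¹ 1ℚ)
  , N , λ n N≤n → ℚₚ.<-≤-trans
      (p-q<ε⇒p<q+ε (seq x n) (seq x N) (ℚₚ.≤-<-trans (p≤∣p∣ _) (close n N N≤n ℕₚ.≤-refl)))
      (ℚₚ.+-monoˡ-≤ 1ℚ (p≤∣p∣ (seq x N)))

divide : ∀ B {ε} → 0ℚ < B → 0ℚ < ε → ∃[ δ ] (0ℚ < δ × δ * B ≡ ε)
divide B {ε} 0<B 0<ε = ε * 1/ B
  , *-pos 0<ε (ℚₚ.positive⁻¹ _ {{ℚₚ.1/pos⇒pos B}})
  , trans (ℚₚ.*-assoc ε (1/ B) B) (trans (cong (ε *_) (ℚₚ.*-inverseˡ B)) (ℚₚ.*-identityʳ ε))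
  where
  instance
    B-pos : ℚ.Positive B
    B-pos = ℚ.positive 0<B
    B-nz : ℚ.NonZero B
    B-nz = ℚₚ.pos⇒nonZero B

-- The slack δ becomes δ * r after multiplication; r < B keeps it below δ * B, which a suitable δ
-- turns into any prescribed ε.
*-mono-<-+ : ∀ p q r {B δ} → 0ℚ < δ → 0ℚ ℚ.≤ r → r < B → p < q + δ → p * r < q * r + δ * B
*-mono-<-+ p q r {B} {δ} 0<δ 0≤r r<B p<q+δ = begin-strict
  p * r           ≤⟨ ℚₚ.*-monoʳ-≤-nonNeg r {{ℚ.nonNegative 0≤r}} (ℚₚ.<⇒≤ p<q+δ) ⟩
  (q + δ) * r     ≡⟨ ℚₚ.*-distribʳ-+ r q δ ⟩
  q * r + δ * r   <⟨ ℚₚ.+-monoʳ-< (q * r) (ℚₚ.*-monoʳ-<-pos δ {{ℚ.positive 0<δ}} r<B) ⟩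
  q * r + δ * B   ∎
  where open ℚₚ.≤-Reasoning

-- Since r stays above δ, the slack ε * δ is less than ε * r, and the whole factor r can be
-- cancelled.
*-cancel-<-+ : ∀ p q r {δ ε} → 0ℚ < δ → 0ℚ < ε → δ < r → p * r < q * r + ε * δ → p < q + ε
*-cancel-<-+ p q r {δ} {ε} 0<δ 0<ε δ<r pr<qr+εδ =
  ℚₚ.*-cancelʳ-<-nonNeg r {{ℚ.nonNegative (ℚₚ.<⇒≤ (ℚₚ.<-trans 0<δ δ<r))}} (begin-strict
    p * r           <⟨ pr<qr+εδ ⟩
    q * r + ε * δ   <⟨ ℚₚ.+-monoʳ-< (q * r) (ℚₚ.*-monoʳ-<-pos ε {{ℚ.positive 0<ε}} δ<r) ⟩
    q * r + ε * r   ≡⟨ ℚₚ.*-distribʳ-+ r q ε ⟨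
    (q + ε) * r     ∎)
  where open ℚₚ.≤-Reasoning

-- Sealed, since the conversion checker compares products x *ᵣ y by unfolding their
-- proofs of convergence.
abstract
  infixl 7 _⊗_

  _⊗_ : ℝ → ℝ → ℝ
  _⊗_ = _*ᵣ_

  ⊗≡*ᵣ : ∀ x y → x ⊗ y ≡ x *ᵣ y
  ⊗≡*ᵣ _ _ = refl

  seq-⊗ : ∀ x y k → seq (x ⊗ y) k ≡ seq x k * seq y k
  seq-⊗ _ _ _ = refl

  ⊗-comm : ∀ x y → x ⊗ y ≗ᵣ y ⊗ x
  ⊗-comm x y k = ℚₚ.*-comm (seq x k) (seq y k)

  ⊗-swapʳ : ∀ x y z → x ⊗ y ⊗ z ≗ᵣ x ⊗ z ⊗ y
  ⊗-swapʳ x y z k =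
    solve 3 (λ p q r → p :* q :* r := p :* r :* q) refl (seq x k) (seq y k) (seq z k)

  ⊗-rotate : ∀ x y z → x ⊗ y ⊗ z ≗ᵣ y ⊗ z ⊗ x
  ⊗-rotate x y z k =
    solve 3 (λ p q r → p :* q :* r := q :* r :* p) refl (seq x k) (seq y k) (seq z k)

  ⊗-nonNeg : ∀ x y → EventuallyNonNeg x → EventuallyNonNeg y → EventuallyNonNeg (x ⊗ y)
  ⊗-nonNeg x y = lift₂ λ n 0≤x 0≤y → ℚₚ.nonNegative⁻¹ _
    {{ℚₚ.nonNeg*nonNeg⇒nonNeg (seq x n) {{ℚ.nonNegative 0≤x}} (seq y n) {{ℚ.nonNegative 0≤y}}}}

  ⊗-monoˡ-≼ : ∀ x y z → EventuallyNonNeg z → x ≼ y → x ⊗ z ≼ y ⊗ z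
  ⊗-monoˡ-≼ x y z 0≤z x≼y .to-≤ᵣ ε 0<ε =
    let B , 0<B , z<B  = eventually-bounded z
        δ , 0<δ , δB≡ε = divide B 0<B 0<ε
    in  bound B δ 0<δ δB≡ε z<B (to-≤ᵣ x≼y δ 0<δ)
    where
    bound : ∀ B δ → 0ℚ < δ → δ * B ≡ ε → Eventually (λ n → seq z n < B) →
      Eventually (λ n → seq x n < seq y n + δ) →
      Eventually (λ n → seq x n * seq z n < seq y n * seq z n + ε)
    bound B δ 0<δ refl z<B x<y+δ = lift₂
      (λ n (0≤z , z<B) → *-mono-<-+ (seq x n) (seq y n) (seq z n) 0<δ 0≤z z<B)
      0≤z<B x<y+δ
      where
      0≤z<B : Eventually λ n → (0ℚ ℚ.≤ seq z n) × (seq z n < B)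
      0≤z<B = lift₂ (λ _ 0≤z z<B → 0≤z , z<B) 0≤z z<B

  ⊗-cancelʳ-≼ : ∀ x y z → 0ℝ <ᵣ z → x ⊗ z ≼ y ⊗ z → x ≼ y
  ⊗-cancelʳ-≼ x y z (δ , 0<δ , N , δ<z) xz≼yz .to-≤ᵣ ε 0<ε = lift₂
    (λ n → *-cancel-<-+ (seq x n) (seq y n) (seq z n) 0<δ 0<ε)
    δ<z′ (to-≤ᵣ xz≼yz (ε * δ) (*-pos 0<ε 0<δ))
    where
    δ<z′ : Eventually λ n → δ < seq z n
    δ<z′ = N , λ n N≤n → subst (_< seq z n) (ℚₚ.+-identityˡ δ) (δ<z n N≤n)

module ≼-Reasoning = Single _≼_ (≗⇒≼ λ _ → refl) ≼-trans

-- With all of a, …, e positive: if a/b ≤ c/d and c/d ≤ d/e, then a/b ≤ d/e.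
ratio-trans : ∀ a b c d e → EventuallyNonNeg b → 0ℝ <ᵣ d → EventuallyNonNeg e →
  a ⊗ d ≼ b ⊗ c → c ⊗ e ≼ d ⊗ d → a ⊗ e ≼ b ⊗ d
ratio-trans a b c d e 0≤b 0<d 0≤e ad≼bc ce≼dd = ⊗-cancelʳ-≼ (a ⊗ e) (b ⊗ d) d 0<d (begin
  a ⊗ e ⊗ d   ∼⟨ ≗⇒≼ (⊗-swapʳ a e d) ⟩
  a ⊗ d ⊗ e   ∼⟨ ⊗-monoˡ-≼ (a ⊗ d) (b ⊗ c) e 0≤e ad≼bc ⟩
  b ⊗ c ⊗ e   ∼⟨ ≗⇒≼ (⊗-rotate b c e) ⟩
  c ⊗ e ⊗ b   ∼⟨ ⊗-monoˡ-≼ (c ⊗ e) (d ⊗ d) b 0≤b ce≼dd ⟩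
  d ⊗ d ⊗ b   ∼⟨ ≗⇒≼ (λ k → sym (⊗-rotate b d d k)) ⟩
  b ⊗ d ⊗ d   ∎)
  where open ≼-Reasoning

-- Strong log-concavity of positive log-concave sequences

module _ (u : ℕ → ℝ) (d : ℕ)
  (u-pos : ∀ j → j ≤ d → 0ℝ <ᵣ u j)
  (u-logConcave : ∀ j → suc (suc j) ≤ d → u j ⊗ u (suc (suc j)) ≼ u (suc j) ⊗ u (suc j))
  where

  -- The ratios satisfy u_p/u_(p+1) ≤ u_r/u_(r+1) by induction and u_r/u_(r+1) ≤ u_(r+1)/u_(r+2) by
  -- log-concavity. The form `≤′` lets the induction raise r while p stays fixed.
  inwards : ∀ p r → p ℕ.≤′ r → suc r ≤ d → u p ⊗ u (suc r) ≼ u (suc p) ⊗ u r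
  inwards p r ℕ.≤′-refl _ = ≗⇒≼ (⊗-comm (u p) (u (suc r)))
  inwards p (suc r) (ℕ.≤′-step p≤r) r+2≤d =
    ratio-trans (u p) (u (suc p)) (u r) (u (suc r)) (u (suc (suc r)))
      (<ᵣ⇒nonNeg (u (suc p)) (u-pos (suc p) p+1≤d))
      (u-pos (suc r) r+1≤d)
      (<ᵣ⇒nonNeg (u (suc (suc r))) (u-pos (suc (suc r)) r+2≤d))
      (inwards p r p≤r r+1≤d)
      (u-logConcave r r+2≤d)
    where
    r+1≤d : suc r ≤ d
    r+1≤d = ℕₚ.≤-trans (ℕₚ.n≤1+n (suc r)) r+2≤d

    p+1≤d : suc p ≤ d
    p+1≤d = ℕₚ.≤-trans (ℕ.s≤s (ℕₚ.≤′⇒≤ p≤r)) r+1≤d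

  -- Each use of `inwards` moves both outer indices one place towards each other and preserves their
  -- sum; `i` counts the moves.
  stronglyLogConcave : ∀ i p n → i ℕ.+ p ≤ n → i ℕ.+ n ≤ d →
    u p ⊗ u (i ℕ.+ n) ≼ u (i ℕ.+ p) ⊗ u n
  stronglyLogConcave zero p n _ _ = ≗⇒≼ λ _ → refl
  stronglyLogConcave (suc i) p n 1+i+p≤n 1+i+n≤d =
    ≼-trans
      (inwards p (i ℕ.+ n) (ℕₚ.≤⇒≤′ p≤i+n) 1+i+n≤d)
      (subst (λ m → u (suc p) ⊗ u (i ℕ.+ n) ≼ u m ⊗ u n) (ℕₚ.+-suc i p)
        (stronglyLogConcave i (suc p) n (subst (_≤ n) (sym (ℕₚ.+-suc i p)) 1+i+p≤n)
          (ℕₚ.≤-trans (ℕₚ.n≤1+n _) 1+i+n≤d)))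
    where
    p≤i+n : p ≤ i ℕ.+ n
    p≤i+n = ℕₚ.≤-trans (ℕₚ.m≤n+m p (suc i)) (ℕₚ.≤-trans 1+i+p≤n (ℕₚ.m≤n+m n i))

-- The coefficients of P, continued by zero beyond the degree

module _ {d : ℕ} (a : Poly d) where

  coeff-∃ : ∀ j → j ≤ d → ∃[ i ] (Fin.toℕ i ≡ j × coeff a j ≡ a i)
  coeff-∃ j j≤d with j ℕₚ.<? suc d
  ... | yes j<1+d = Fin.fromℕ< j<1+d , Finₚ.toℕ-fromℕ< j<1+d , refl
  ... | no  j≮1+d = ⊥-elim (j≮1+d (ℕ.s≤s j≤d))

  coeff-toℕ : ∀ i → coeff a (Fin.toℕ i) ≡ a i
  coeff-toℕ i with Fin.toℕ i ℕₚ.<? suc d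
  ... | yes i<1+d = cong a (Finₚ.fromℕ<-toℕ i i<1+d)
  ... | no  i≮1+d = ⊥-elim (i≮1+d (Finₚ.toℕ<n i))

  coeff-⊗ : ∀ i j {k l} → k ≡ Fin.toℕ i → l ≡ Fin.toℕ j → coeff a k ⊗ coeff a l ≡ a i *ᵣ a j
  coeff-⊗ i j refl refl = trans (cong₂ _⊗_ (coeff-toℕ i) (coeff-toℕ j)) (⊗≡*ᵣ (a i) (a j))

  coeff-above : ∀ j → d ℕ.< j → coeff a j ≡ 0ℝ
  coeff-above j d<j with j ℕₚ.<? suc d
  ... | yes j<1+d = ⊥-elim (ℕₚ.<⇒≱ d<j (ℕ.s≤s⁻¹ j<1+d))
  ... | no  _     = refl

  module _ (a-pos : ∀ j → 0ℝ <ᵣ a j) where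

    coeff-pos : ∀ j → j ≤ d → 0ℝ <ᵣ coeff a j
    coeff-pos j j≤d with coeff-∃ j j≤d
    ... | i , _ , eq = subst (0ℝ <ᵣ_) (sym eq) (a-pos i)

    coeff-nonNeg : ∀ j → EventuallyNonNeg (coeff a j)
    coeff-nonNeg j with j ℕₚ.≤? d
    ... | yes j≤d = <ᵣ⇒nonNeg (coeff a j) (coeff-pos j j≤d)
    ... | no  j≰d = subst EventuallyNonNeg (sym (coeff-above j (ℕₚ.≰⇒> j≰d)))
                      (0 , λ _ _ → ℚₚ.≤-refl)

    module _ (a-logConcave : LogConcave a) where

      coeff-logConcave : ∀ j → suc (suc j) ≤ d →
        coeff a j ⊗ coeff a (suc (suc j)) ≼ coeff a (suc j) ⊗ coeff a (suc j)
      coeff-logConcave j j+2≤d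
        with coeff-∃ j (ℕₚ.≤-trans (ℕₚ.m≤n+m j 2) j+2≤d)
           | coeff-∃ (suc j) (ℕₚ.≤-trans (ℕₚ.n≤1+n (suc j)) j+2≤d)
           | coeff-∃ (suc (suc j)) j+2≤d
      ... | i , i≡ , eqᵢ | k , k≡ , eqₖ | l , l≡ , eqₗ
        rewrite eqᵢ | eqₖ | eqₗ =
        subst₂ _≼_ (sym (⊗≡*ᵣ _ _)) (sym (⊗≡*ᵣ _ _))
          (from-≤ᵣ (a-logConcave i k l (trans k≡ (cong suc (sym i≡))) (trans l≡ (cong suc (sym k≡)))))

      -- For r ≥ d the left side contains the zero coefficient a_(r+1) and the right side is
      -- nonnegative. Having no upper bound on r is what partitions with large parts require.
      coeff-inwards : ∀ p r → p ≤ r →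
        coeff a (suc r) ⊗ coeff a p ≼ coeff a r ⊗ coeff a (suc p)
      coeff-inwards p r p≤r with suc r ℕₚ.≤? d
      ... | yes 1+r≤d = begin
        coeff a (suc r) ⊗ coeff a p   ∼⟨ ≗⇒≼ (⊗-comm (coeff a (suc r)) (coeff a p)) ⟩
        coeff a p ⊗ coeff a (suc r)   ∼⟨ inwards (coeff a) d coeff-pos coeff-logConcave p r (ℕₚ.≤⇒≤′ p≤r) 1+r≤d ⟩
        coeff a (suc p) ⊗ coeff a r   ∼⟨ ≗⇒≼ (⊗-comm (coeff a (suc p)) (coeff a r)) ⟩
        coeff a r ⊗ coeff a (suc p)   ∎
        where open ≼-Reasoning
      ... | no  1+r≰d = begin
        coeff a (suc r) ⊗ coeff a p   ≡⟨ cong (_⊗ coeff a p) (coeff-above (suc r) (ℕₚ.≰⇒> 1+r≰d)) ⟩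
        0ℝ ⊗ coeff a p                ∼⟨ ≗⇒≼ (λ k → trans (seq-⊗ 0ℝ (coeff a p) k) (ℚₚ.*-zeroˡ (seq (coeff a p) k))) ⟩
        0ℝ                            ∼⟨ nonNeg⇒≽0 (⊗-nonNeg _ (coeff a (suc p)) (coeff-nonNeg r) (coeff-nonNeg (suc p))) ⟩
        coeff a r ⊗ coeff a (suc p)   ∎
        where open ≼-Reasoning

      logConcave⇒stronglyLogConcave : StronglyLogConcave a
      logConcave⇒stronglyLogConcave p m n q p<m m≤n n<q m+n≡p+q = to-≤ᵣ
        (subst₂ _≼_ (coeff-⊗ p q refl i+n≡q) (coeff-⊗ m n i+p≡m refl)
          (stronglyLogConcave (coeff a) d coeff-pos coeff-logConcave i (Fin.toℕ p) (Fin.toℕ n)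
            (subst (_≤ Fin.toℕ n) (sym i+p≡m) m≤n)
            (subst (_≤ d) (sym i+n≡q) (ℕ.s≤s⁻¹ (Finₚ.toℕ<n q)))))
        where
        i : ℕ
        -- The sum condition makes this also the distance from n to q.
        i = Fin.toℕ m ∸ Fin.toℕ p

        i+p≡m : i ℕ.+ Fin.toℕ p ≡ Fin.toℕ m
        i+p≡m = ℕₚ.m∸n+n≡m (ℕₚ.<⇒≤ p<m)

        i+n≡q : i ℕ.+ Fin.toℕ n ≡ Fin.toℕ q
        i+n≡q = ℕₚ.+-cancelˡ-≡ (Fin.toℕ p) _ _ (begin
          Fin.toℕ p ℕ.+ (i ℕ.+ Fin.toℕ n)   ≡⟨ ℕₚ.+-assoc (Fin.toℕ p) i (Fin.toℕ n) ⟨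
          Fin.toℕ p ℕ.+ i ℕ.+ Fin.toℕ n     ≡⟨ cong (ℕ._+ Fin.toℕ n) (trans (ℕₚ.+-comm (Fin.toℕ p) i) i+p≡m) ⟩
          Fin.toℕ m ℕ.+ Fin.toℕ n           ≡⟨ m+n≡p+q ⟩
          Fin.toℕ p ℕ.+ Fin.toℕ q           ∎)
          where open ≡-Reasoning

  stronglyLogConcave⇒logConcave : StronglyLogConcave a → LogConcave a
  stronglyLogConcave⇒logConcave slc i j k j≡1+i k≡1+j =
    slc i j j k (ℕₚ.≤-reflexive (sym j≡1+i)) ℕₚ.≤-refl (ℕₚ.≤-reflexive (sym k≡1+j))
      (trans (cong (ℕ._+ Fin.toℕ j) j≡1+i)
        (sym (trans (cong (Fin.toℕ i ℕ.+_) k≡1+j) (ℕₚ.+-suc (Fin.toℕ i) (Fin.toℕ j)))))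

-- Counting in enumerations of words, fillings and partitions

module _ {A : Set} where

  length-singleton : ∀ {xs} {t : A} → Unique xs → t ∈ xs → (∀ {x} → x ∈ xs → x ≡ t) → length xs ≡ 1
  length-singleton {_ ∷ []}     _                 _ _   = refl
  length-singleton {_ ∷ _ ∷ _} ((x≢y ∷ _) ∷ _) _ ≡t =
    ⊥-elim (x≢y (trans (≡t (here refl)) (sym (≡t (there (here refl))))))

  module _ {P : A → Set} (P? : Decidable P) where

    -- The tableau counts needed below are all 0 or 1. The value 1 takes a witness, its uniqueness,
    -- and an enumeration free of repetitions, hence the `Unique` lemmas.
    count-one : ∀ {xs t} → Unique xs → t ∈ xs → P t → (∀ {x} → x ∈ xs → P x → x ≡ t) →
      length (filter P? xs) ≡ 1
    count-one {xs} xs! t∈xs Pt ≡t = length-singleton (Uniqueₚ.filter⁺ P? xs!) (∈-filter⁺ P? t∈xs Pt)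
      λ x∈ → let x∈xs , Px = ∈-filter⁻ P? {xs = xs} x∈ in ≡t x∈xs Px

    count-zero : ∀ {xs} → (∀ {x} → x ∈ xs → ¬ P x) → length (filter P? xs) ≡ 0
    count-zero ¬P = cong length (filter-none P? (All.tabulate ¬P))

  ∈-choices⁺ : ∀ {xs : List A} {xss} → Pointwise _∈_ xs xss → xs ∈ choices xss
  ∈-choices⁺ []           = here refl
  ∈-choices⁺ (x∈ ∷ xs∈) = ∈-cartesianProductWith⁺ _∷_ x∈ (∈-choices⁺ xs∈)

  ∈-choices⁻ : ∀ {xs : List A} xss → xs ∈ choices xss → Pointwise _∈_ xs xss
  ∈-choices⁻ []         (here refl) = []
  ∈-choices⁻ (ys ∷ xss) xs∈ with ∈-cartesianProductWith⁻ _∷_ ys (choices xss) xs∈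
  ... | _ , _ , y∈ , zs∈ , refl = y∈ ∷ ∈-choices⁻ xss zs∈

  choices-unique : ∀ {xss : List (List A)} → All Unique xss → Unique (choices xss)
  choices-unique []           = [] ∷ []
  choices-unique (xs! ∷ xss!) =
    Uniqueₚ.cartesianProductWith⁺ _∷_ ∷-injective xs! (choices-unique xss!)

∈-words⁺ : ∀ {k w} → All (ℕ._< k) w → w ∈ words k (length w)
∈-words⁺ w<k = ∈-choices⁺ (pointwise w<k)
  where
  pointwise : ∀ {k w} → All (ℕ._< k) w → Pointwise _∈_ w (replicate (length w) (upTo k))
  pointwise []          = []
  pointwise (i<k ∷ w<k) = ∈-upTo⁺ i<k ∷ pointwise w<k

∈-words⁻ : ∀ {k w} r → w ∈ words k r → length w ≡ r × All (ℕ._< k) w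
∈-words⁻ {k} r w∈ = pointwise r (∈-choices⁻ (replicate r (upTo k)) w∈)
  where
  pointwise : ∀ {w} r → Pointwise _∈_ w (replicate r (upTo k)) → length w ≡ r × All (ℕ._< k) w
  pointwise zero    []        = refl , []
  pointwise (suc r) (i∈ ∷ w∈) with pointwise r w∈
  ... | refl , w<k = refl , ∈-upTo⁻ i∈ ∷ w<k

words-unique : ∀ k r → Unique (words k r)
words-unique k r = choices-unique (Allₚ.replicate⁺ r (Uniqueₚ.upTo⁺ k))

words-disjoint : ∀ {k r s} → r ≢ s → Disjoint (words k r) (words k s)
words-disjoint {_} {r} {s} r≢s (w∈r , w∈s) =
  r≢s (trans (sym (proj₁ (∈-words⁻ r w∈r))) (proj₁ (∈-words⁻ s w∈s)))

fillings-unique : ∀ k ν → Unique (fillings k ν)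
fillings-unique k ν = choices-unique (Allₚ.map⁺ (All.universal (words-unique k) ν))

partition-of? : ∀ n → Decidable (λ ν → IsPartition ν × sum ν ≡ n)
partition-of? n ν = isPartition? ν ×-dec (sum ν ℕₚ.≟ n)

partitions-unique : ∀ n → Unique (partitions n)
partitions-unique n = Uniqueₚ.filter⁺ (partition-of? n) (Uniqueₚ.concat⁺
  (Allₚ.map⁺ (All.universal (words-unique (suc n)) (upTo (suc n))))
  (AllPairsₚ.map⁺ (AllPairs.map words-disjoint (Uniqueₚ.upTo⁺ (suc n)))))

∈-partitions⁻ : ∀ {n ν} → ν ∈ partitions n → IsPartition ν × sum ν ≡ n
∈-partitions⁻ {n} ν∈ =
  proj₂ (∈-filter⁻ (partition-of? n) {xs = concatMap (words (suc n)) (upTo (suc n))} ν∈)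

length≤sum : ∀ {ν} → All (0 ℕ.<_) ν → length ν ≤ sum ν
length≤sum []          = z≤n
length≤sum (0<i ∷ 0<ν) = ℕₚ.+-mono-≤ 0<i (length≤sum 0<ν)

All-≤sum : ∀ ν → All (_≤ sum ν) ν
All-≤sum []      = []
All-≤sum (i ∷ ν) = ℕₚ.m≤m+n i (sum ν) ∷ All.map (λ j≤ → ℕₚ.≤-trans j≤ (ℕₚ.m≤n+m (sum ν) i)) (All-≤sum ν)

-- All parts are positive, so neither their number nor their size exceeds the sum; the bounds built
-- into the enumeration lose nothing.
∈-partitions⁺ : ∀ {ν} → IsPartition ν → ν ∈ partitions (sum ν)
∈-partitions⁺ {ν} ν-partition@(_ , 0<ν) = ∈-filter⁺ (partition-of? (sum ν))
  (∈-concat⁺′ (∈-words⁺ (All.map s≤s (All-≤sum ν)))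
    (∈-map⁺ (words (suc (sum ν))) (∈-upTo⁺ (s≤s (length≤sum 0<ν)))))
  (ν-partition , refl)

-- Semistandard tableaux with entries 0 and 1

count : ℕ → List ℕ → ℕ
count i w = length (filter (i ℕₚ.≟_) w)

count-++ : ∀ i v w → count i (v ++ w) ≡ count i v ℕ.+ count i w
count-++ i v w = trans (cong length (filter-++ (i ℕₚ.≟_) v w)) (length-++ (filter (i ℕₚ.≟_) v))

count-replicate-≡ : ∀ i n → count i (replicate n i) ≡ n
count-replicate-≡ i n =
  trans (cong length (filter-all (i ℕₚ.≟_) (Allₚ.replicate⁺ n refl))) (length-replicate n)

count-replicate-≢ : ∀ {i j} n → i ≢ j → count i (replicate n j) ≡ 0
count-replicate-≢ {i} n i≢j = count-zero (i ℕₚ.≟_) λ k∈ i≡k →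
  i≢j (trans i≡k (All.lookup (Allₚ.replicate⁺ {P = _≡ _} n refl) k∈))

row : ℕ → ℕ → List ℕ
row m n = replicate m 0 ++ replicate n 1

length-row : ∀ m n → length (row m n) ≡ m ℕ.+ n
length-row m n = trans (length-++ (replicate m 0)) (cong₂ ℕ._+_ (length-replicate m) (length-replicate n))

row<2 : ∀ m n → All (ℕ._< 2) (row m n)
row<2 m n = Allₚ.++⁺ (Allₚ.replicate⁺ m (s≤s z≤n)) (Allₚ.replicate⁺ n (s≤s (s≤s z≤n)))

row-sorted : ∀ m n → Linked _≤_ (row m n)
row-sorted zero zero                = []
row-sorted zero (suc zero)          = [-]
row-sorted zero (suc (suc n))       = ℕₚ.≤-refl ∷ row-sorted zero (suc n)
row-sorted (suc zero) zero          = [-]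
row-sorted (suc zero) (suc n)       = z≤n ∷ row-sorted zero (suc n)
row-sorted (suc (suc m)) n          = z≤n ∷ row-sorted (suc m) n

sorted⇒row : ∀ {w} → Linked _≤_ w → All (ℕ._< 2) w → ∃[ m ] ∃[ n ] w ≡ row m n
sorted⇒row {[]} _ _ = 0 , 0 , refl
sorted⇒row {i ∷ w} w↗ (i<2 ∷ w<2) with sorted⇒row (Linked.tail w↗) w<2
sorted⇒row {zero ∷ w}        _         _                   | m , n , refl = suc m , n , refl
sorted⇒row {suc zero ∷ w}    _         _                   | zero , n , refl = 0 , suc n , refl
sorted⇒row {suc zero ∷ w}    (() ∷ _)  _                   | suc m , n , refl
sorted⇒row {suc (suc _) ∷ w} _         (s≤s (s≤s ()) ∷ _) | _

-- Exceeding the entry above excludes 0, which leaves only 1.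
below-row : ∀ {v w} → Prefix ℕ._>_ v w → All (ℕ._< 2) v → v ≡ replicate (length v) 1
below-row []                              []                   = refl
below-row (_∷_ {a = zero} () _)           _
below-row (_∷_ {a = suc zero} _ v>w)      (_ ∷ v<2)            = cong (1 ∷_) (below-row v>w v<2)
below-row (_∷_ {a = suc (suc _)} _ _)     (s≤s (s≤s ()) ∷ _)

ones-below-row : ∀ {q m} n → q ≤ m → Prefix ℕ._>_ (replicate q 1) (row m n)
ones-below-row n z≤n       = []
ones-below-row n (s≤s q≤m) = s≤s z≤n ∷ ones-below-row n q≤m

count-row₀ : ∀ m n → count 0 (row m n) ≡ m
count-row₀ m n = trans (count-++ 0 (replicate m 0) (replicate n 1))
  (trans (cong₂ ℕ._+_ (count-replicate-≡ 0 m) (count-replicate-≢ n λ ())) (ℕₚ.+-identityʳ m))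

count-row₁ : ∀ m n → count 1 (row m n) ≡ n
count-row₁ m n = trans (count-++ 1 (replicate m 0) (replicate n 1))
  (cong₂ ℕ._+_ (count-replicate-≢ m λ ()) (count-replicate-≡ 1 n))

content-one-row : ∀ m n → content 2 (row m n ∷ []) ≡ m ∷ n ∷ []
content-one-row m n = cong₂ (λ i j → i ∷ j ∷ [])
  (trans (count-++ 0 (row m n) []) (trans (ℕₚ.+-identityʳ _) (count-row₀ m n)))
  (trans (count-++ 1 (row m n) []) (trans (ℕₚ.+-identityʳ _) (count-row₁ m n)))

content-two-rows : ∀ m n q → content 2 (row m n ∷ replicate q 1 ∷ []) ≡ m ∷ n ℕ.+ q ∷ []
content-two-rows m n q = cong₂ (λ i j → i ∷ j ∷ [])
  (trans (count-++ 0 (row m n) (concat (replicate q 1 ∷ [])))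
    (trans (cong₂ ℕ._+_ (count-row₀ m n)
      (trans (count-++ 0 (replicate q 1) []) (trans (ℕₚ.+-identityʳ _) (count-replicate-≢ q λ ()))))
      (ℕₚ.+-identityʳ m)))
  (trans (count-++ 1 (row m n) (concat (replicate q 1 ∷ [])))
    (cong₂ ℕ._+_ (count-row₁ m n)
      (trans (count-++ 1 (replicate q 1) []) (trans (ℕₚ.+-identityʳ _) (count-replicate-≡ 1 q)))))

-- Kostka numbers for two variables

tableau-of-content? : ∀ α → Decidable (λ T → Semistandard T × content (length α) T ≡ α)
tableau-of-content? α T = semistandard? T ×-dec ≡-dec ℕₚ._≟_ (content (length α) T) α

-- The coefficient of x₀^m x₁^n in s_ν.
kostka : List ℕ → ℕ → ℕ → ℕ
kostka ν m n = length (filter (tableau-of-content? (m ∷ n ∷ [])) (fillings 2 ν))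

row∈words : ∀ m n {p} → m ℕ.+ n ≡ p → row m n ∈ words 2 p
row∈words m n m+n≡p =
  subst (λ p → row m n ∈ words 2 p) (trans (length-row m n) m+n≡p) (∈-words⁺ (row<2 m n))

kostka-one-row : ∀ {p} m n → m ℕ.+ n ≡ p → kostka (p ∷ []) m n ≡ 1
kostka-one-row {p} m n m+n≡p = count-one (tableau-of-content? (m ∷ n ∷ [])) (fillings-unique 2 (p ∷ []))
  (∈-choices⁺ (row∈words m n m+n≡p ∷ []))
  ((row-sorted m n ∷ [] , [-]) , content-one-row m n)
  unique
  where
  unique : ∀ {T} → T ∈ fillings 2 (p ∷ []) → Semistandard T × content 2 T ≡ m ∷ n ∷ [] →
    T ≡ row m n ∷ []
  unique T∈ ((T↗ , _) , T-content) with ∈-choices⁻ (words 2 p ∷ []) T∈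
  unique T∈ ((w↗ ∷ [] , _) , T-content) | w∈ ∷ [] with sorted⇒row w↗ (proj₂ (∈-words⁻ p w∈))
  ... | m′ , n′ , refl with trans (sym (content-one-row m′ n′)) T-content
  ... | refl = refl

-- The second row consists of q ones, so only n - q ones remain for the first. This yields
-- uniqueness when q ≤ n and nonexistence when q > n.
two-row-tableau : ∀ {p q m n T} → T ∈ fillings 2 (p ∷ q ∷ []) → Semistandard T →
  content 2 T ≡ m ∷ n ∷ [] → ∃[ k ] (k ℕ.+ q ≡ n × T ≡ row m k ∷ replicate q 1 ∷ [])
two-row-tableau {p} {q} T∈ T-ssyt T-content with ∈-choices⁻ (words 2 p ∷ words 2 q ∷ []) T∈
two-row-tableau {p} {q} T∈ (w↗ ∷ _ ∷ [] , v>w ∷ [-]) T-content | w∈ ∷ v∈ ∷ []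
  with ∈-words⁻ q v∈
... | refl , v<2 with sorted⇒row w↗ (proj₂ (∈-words⁻ p w∈)) | below-row v>w v<2
... | m , k , refl | v≡
  with trans (sym (content-two-rows m k q))
         (trans (cong (λ v → content 2 (row m k ∷ v ∷ [])) (sym v≡)) T-content)
... | refl = k , refl , cong (λ v → row m k ∷ v ∷ []) v≡

kostka-two-rows : ∀ {p q} m n → p ℕ.+ q ≡ m ℕ.+ n → q ≤ m → q ≤ n → kostka (p ∷ q ∷ []) m n ≡ 1
kostka-two-rows {p} {q} m n p+q≡m+n q≤m q≤n =
  count-one (tableau-of-content? (m ∷ n ∷ [])) (fillings-unique 2 (p ∷ q ∷ []))
    (∈-choices⁺ (row∈words m (n ∸ q) m+[n-q]≡p ∷ v∈ ∷ []))
    -- Here q ≤ m enters: the q ones of the second row must all stand below zeros.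
    ((row-sorted m (n ∸ q) ∷ row-sorted 0 q ∷ [] , ones-below-row (n ∸ q) q≤m ∷ [-])
    , trans (content-two-rows m (n ∸ q) q) (cong (λ k → m ∷ k ∷ []) (ℕₚ.m∸n+n≡m q≤n)))
    unique
  where
  m+[n-q]≡p : m ℕ.+ (n ∸ q) ≡ p
  m+[n-q]≡p = trans (sym (ℕₚ.+-∸-assoc m q≤n)) (trans (cong (_∸ q) (sym p+q≡m+n)) (ℕₚ.m+n∸n≡m p q))

  v∈ : replicate q 1 ∈ words 2 q
  v∈ = row∈words 0 q refl

  unique : ∀ {T} → T ∈ fillings 2 (p ∷ q ∷ []) → Semistandard T × content 2 T ≡ m ∷ n ∷ [] →
    T ≡ row m (n ∸ q) ∷ replicate q 1 ∷ []
  unique T∈ (T-ssyt , T-content) with two-row-tableau {p} {q} T∈ T-ssyt T-content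
  ... | k , refl , refl = cong (λ k → row m k ∷ replicate q 1 ∷ []) (sym (ℕₚ.m+n∸n≡m k q))

kostka-two-rows-zero : ∀ {p q} m n → n ℕ.< q → kostka (p ∷ q ∷ []) m n ≡ 0
kostka-two-rows-zero {p} {q} m n n<q = count-zero (tableau-of-content? (m ∷ n ∷ []))
  λ T∈ (T-ssyt , T-content) →
    let k , k+q≡n , _ = two-row-tableau {p} {q} T∈ T-ssyt T-content
    in  ℕₚ.<⇒≱ n<q (ℕₚ.≤-trans (ℕₚ.m≤n+m q k) (ℕₚ.≤-reflexive k+q≡n))

-- The first column would contain three strictly increasing entries below 2.
kostka-long-zero : ∀ {p q r ν} m n → 0 ℕ.< r → kostka (p ∷ q ∷ r ∷ ν) m n ≡ 0
kostka-long-zero {p} {q} {r} {ν} m n 0<r = count-zero (tableau-of-content? (m ∷ n ∷ []))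
  λ T∈ (T-ssyt , _) → impossible (∈-choices⁻ (map (words 2) (p ∷ q ∷ r ∷ ν)) T∈) T-ssyt
  where
  no-descent : ∀ {u v w} → 0 ℕ.< length w → All (ℕ._< 2) w → Prefix ℕ._>_ v u → ¬ Prefix ℕ._>_ w v
  no-descent _ (k<2 ∷ _) (i<j ∷ _) (j<k ∷ _) =
    ℕₚ.<⇒≱ k<2 (ℕₚ.≤-trans (s≤s (ℕₚ.≤-trans (s≤s z≤n) i<j)) j<k)

  impossible : ∀ {T} → Pointwise _∈_ T (map (words 2) (p ∷ q ∷ r ∷ ν)) → ¬ Semistandard T
  impossible (_ ∷ _ ∷ w∈ ∷ _) (_ , v>u ∷ lower) with ∈-words⁻ r w∈
  impossible (_ ∷ _ ∷ _ ∷ _)  (_ , v>u ∷ w>v ∷ _) | refl , w<2 = no-descent 0<r w<2 v>u w>v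

-- For two rows the counts are the indicators of q ≤ n+1 and of q ≤ n. They differ only at q = n+1,
-- where the sum forces p = m, the excluded partition. The bound n < m supplies q ≤ m for column
-- strictness.
kostka-shift : ∀ {ν m n} → n ℕ.< m → IsPartition ν → sum ν ≡ m ℕ.+ suc n →
  ν ≢ m ∷ suc n ∷ [] → kostka ν m (suc n) ≡ kostka ν (suc m) n
kostka-shift {[]} {m} {n} _ _ 0≡ _ with trans 0≡ (ℕₚ.+-suc m n)
... | ()
kostka-shift {p ∷ []} {m} {n} _ _ p≡ _ =
  trans (kostka-one-row m (suc n) m+n≡p) (sym (kostka-one-row (suc m) n (trans (sym (ℕₚ.+-suc m n)) m+n≡p)))
  where
  m+n≡p : m ℕ.+ suc n ≡ p
  m+n≡p = trans (sym p≡) (ℕₚ.+-identityʳ p)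
kostka-shift {p ∷ q ∷ []} {m} {n} n<m _ p+q≡ ν≢ with ℕₚ.<-cmp q (suc n)
... | tri< q<1+n _ _ = trans
  (kostka-two-rows m (suc n) p+q≡m+n (ℕₚ.≤-trans (ℕ.s≤s⁻¹ q<1+n) (ℕₚ.<⇒≤ n<m)) (ℕₚ.<⇒≤ q<1+n))
  (sym (kostka-two-rows (suc m) n (trans p+q≡m+n (ℕₚ.+-suc m n))
    (ℕₚ.≤-trans (ℕ.s≤s⁻¹ q<1+n) (ℕₚ.≤-trans (ℕₚ.<⇒≤ n<m) (ℕₚ.n≤1+n m))) (ℕ.s≤s⁻¹ q<1+n)))
  where
  p+q≡m+n : p ℕ.+ q ≡ m ℕ.+ suc n
  p+q≡m+n = trans (cong (p ℕ.+_) (sym (ℕₚ.+-identityʳ q))) p+q≡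
... | tri≈ _ refl _ = ⊥-elim (ν≢ (cong (_∷ suc n ∷ [])
  (ℕₚ.+-cancelʳ-≡ (suc n) p m (trans (cong (p ℕ.+_) (sym (ℕₚ.+-identityʳ (suc n)))) p+q≡))))
... | tri> _ _ 1+n<q = trans (kostka-two-rows-zero {p} m (suc n) 1+n<q)
  (sym (kostka-two-rows-zero {p} (suc m) n (ℕₚ.<⇒≤ 1+n<q)))
kostka-shift {p ∷ q ∷ r ∷ ν} {m} {n} _ (_ , _ ∷ _ ∷ 0<r ∷ _) _ _ =
  trans (kostka-long-zero {p} {q} {r} {ν} m (suc n) 0<r) (sym (kostka-long-zero {p} {q} {r} {ν} (suc m) n 0<r))

-- Partitions have no zero parts, so for m = 0 the row is the empty list.
rowPartition : ℕ → List ℕ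
rowPartition zero    = []
rowPartition (suc m) = suc m ∷ []

kostka-row : ∀ m → kostka (rowPartition m) m 0 ≡ 1
kostka-row zero    = refl
kostka-row (suc m) = kostka-one-row (suc m) 0 (ℕₚ.+-identityʳ (suc m))

-- A second row would need an entry 1, but x₁ has exponent 0.
kostka-row-zero : ∀ {ν m} → IsPartition ν → sum ν ≡ m → ν ≢ rowPartition m → kostka ν m 0 ≡ 0
kostka-row-zero {[]} _ refl ν≢ = ⊥-elim (ν≢ refl)
kostka-row-zero {zero ∷ []} (_ , () ∷ _) _ _
kostka-row-zero {suc p ∷ []} _ refl ν≢ =
  ⊥-elim (ν≢ (cong (λ k → suc k ∷ []) (sym (ℕₚ.+-identityʳ p))))
kostka-row-zero {p ∷ q ∷ []} {m} (_ , _ ∷ 0<q ∷ []) _ _ = kostka-two-rows-zero {p} m 0 0<q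
kostka-row-zero {p ∷ q ∷ r ∷ ν} {m} (_ , _ ∷ _ ∷ 0<r ∷ _) _ _ = kostka-long-zero {p} {q} {r} {ν} m 0 0<r

-- Finite sums, evaluated at a fixed index of the sequences

Σℚ : {A : Set} → List A → (A → ℚ) → ℚ
Σℚ []       f = 0ℚ
Σℚ (x ∷ xs) f = f x + Σℚ xs f

seq-Σᵣ : ∀ {A : Set} (xs : List A) (f : A → ℝ) k →
  seq (Σᵣ xs f) k ≡ Σℚ xs (λ x → seq (f x) k)
seq-Σᵣ []       f k = refl
seq-Σᵣ (x ∷ xs) f k = cong (seq (f x) k +_) (seq-Σᵣ xs f k)

seq-*ₛ : ∀ f g α k →
  seq ((f *ₛ g) α) k ≡ Σℚ (factorisations α) λ (β , γ) → seq (f β) k * seq (g γ) k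
seq-*ₛ f g α k = seq-Σᵣ (factorisations α) (λ (β , γ) → f β *ᵣ g γ) k

module _ {A : Set} where

  Σℚ-cong : ∀ {f g : A → ℚ} {xs} → (∀ {x} → x ∈ xs → f x ≡ g x) → Σℚ xs f ≡ Σℚ xs g
  Σℚ-cong {xs = []}     _   = refl
  Σℚ-cong {xs = x ∷ xs} f≡g = cong₂ _+_ (f≡g (here refl)) (Σℚ-cong (f≡g ∘ there))

  -- Cancellation of all common terms, in additive form; absence of repetitions ensures that t
  -- contributes only once.
  Σℚ-differ : ∀ {f g : A → ℚ} {xs t} → Unique xs → t ∈ xs →
    (∀ {x} → x ∈ xs → x ≢ t → f x ≡ g x) → g t ≡ 0ℚ → Σℚ xs f ≡ Σℚ xs g + f t
  Σℚ-differ {f} {g} {t ∷ xs} (t∉xs ∷ _) (here refl) f≡g gt≡0 = begin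
    f t + Σℚ xs f         ≡⟨ ℚₚ.+-comm (f t) (Σℚ xs f) ⟩
    Σℚ xs f + f t         ≡⟨ cong (_+ f t) (Σℚ-cong λ x∈xs →
                              f≡g (there x∈xs) (All.lookup t∉xs x∈xs ∘ sym)) ⟩
    Σℚ xs g + f t         ≡⟨ cong (_+ f t) (ℚₚ.+-identityˡ (Σℚ xs g)) ⟨
    0ℚ + Σℚ xs g + f t    ≡⟨ cong (λ p → p + Σℚ xs g + f t) gt≡0 ⟨
    g t + Σℚ xs g + f t   ∎
    where open ≡-Reasoning
  Σℚ-differ {f} {g} {x ∷ xs} {t} (x∉xs ∷ xs!) (there t∈xs) f≡g gt≡0 = trans
    (cong₂ _+_ (f≡g (here refl) (All.lookup x∉xs t∈xs)) (Σℚ-differ xs! t∈xs (f≡g ∘ there) gt≡0))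
    (sym (ℚₚ.+-assoc (g x) (Σℚ xs g) (f t)))

  Σℚ-zero : ∀ (xs : List A) → Σℚ xs (λ _ → 0ℚ) ≡ 0ℚ
  Σℚ-zero []       = refl
  Σℚ-zero (_ ∷ xs) = trans (ℚₚ.+-identityˡ _) (Σℚ-zero xs)

  Σℚ-single : ∀ {f : A → ℚ} {xs t} → Unique xs → t ∈ xs →
    (∀ {x} → x ∈ xs → x ≢ t → f x ≡ 0ℚ) → Σℚ xs f ≡ f t
  Σℚ-single {f} {xs} {t} xs! t∈xs f≡0 = trans
    (Σℚ-differ {g = λ _ → 0ℚ} xs! t∈xs f≡0 refl)
    (trans (cong (_+ f t) (Σℚ-zero xs)) (ℚₚ.+-identityˡ (f t)))

-- The coefficient of x₀^m x₁^n in the product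

factorise : ℕ → ℕ → Monomial × Monomial → Monomial × Monomial
factorise n i (β , γ) = i ∷ β , (n ∸ i) ∷ γ

factorisations-unique : ∀ α → Unique (factorisations α)
factorisations-unique []      = [] ∷ []
factorisations-unique (n ∷ α) = Uniqueₚ.cartesianProductWith⁺ (factorise n)
  (λ eq → ∷-injectiveˡ (cong proj₁ eq)
        , cong₂ _,_ (∷-injectiveʳ (cong proj₁ eq)) (∷-injectiveʳ (cong proj₂ eq)))
  (Uniqueₚ.upTo⁺ (suc n)) (factorisations-unique α)

zeros : Monomial → Monomial
zeros = map λ _ → 0

trivialFactorisation : Monomial → Monomial × Monomial
trivialFactorisation α = zeros α , α

trivial∈factorisations : ∀ α → trivialFactorisation α ∈ factorisations α
trivial∈factorisations []      = here refl
trivial∈factorisations (n ∷ α) =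
  ∈-cartesianProductWith⁺ (factorise n) (∈-upTo⁺ {suc n} (s≤s z≤n)) (trivial∈factorisations α)

IsOne-factor : ∀ α {β γ} → (β , γ) ∈ factorisations α → IsOne β → (β , γ) ≡ trivialFactorisation α
IsOne-factor []      (here refl) _ = refl
IsOne-factor (n ∷ α) βγ∈ one
  with ∈-cartesianProductWith⁻ (factorise n) (upTo (suc n)) (factorisations α) βγ∈
IsOne-factor (n ∷ α) βγ∈ (refl ∷ one) | _ , _ , _ , βγ∈′ , refl
  with IsOne-factor α βγ∈′ one
... | refl = refl

IsOne-zeros : ∀ α → IsOne (zeros α)
IsOne-zeros []      = []
IsOne-zeros (_ ∷ α) = refl ∷ IsOne-zeros α

-- Removes the empty product from which `partialProduct` starts: only the factorisation whose first
-- factor is 1 contributes.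
oneₛ-identityˡ : ∀ f α → (oneₛ *ₛ f) α ≗ᵣ f α
oneₛ-identityˡ f α k = begin
  seq ((oneₛ *ₛ f) α) k                         ≡⟨ seq-*ₛ oneₛ f α k ⟩
  _                                             ≡⟨ Σℚ-single (factorisations-unique α) (trivial∈factorisations α) vanish ⟩
  seq (oneₛ (zeros α)) k * seq (f α) k  ≡⟨ cong (λ b → seq (if b then 1ℝ else 0ℝ) k * seq (f α) k)
                                                     (dec-true (isOne? (zeros α)) (IsOne-zeros α)) ⟩
  1ℚ * seq (f α) k                              ≡⟨ ℚₚ.*-identityˡ (seq (f α) k) ⟩
  seq (f α) k                                   ∎
  where
  open ≡-Reasoning

  vanish : ∀ {x} → x ∈ factorisations α → x ≢ trivialFactorisation α →
    seq (oneₛ (proj₁ x)) k * seq (f (proj₂ x)) k ≡ 0ℚ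
  vanish {β , γ} x∈ x≢ = trans
    (cong (λ b → seq (if b then 1ℝ else 0ℝ) k * seq (f γ) k)
      (dec-false (isOne? β) (x≢ ∘ IsOne-factor α x∈)))
    (ℚₚ.*-zeroˡ (seq (f γ) k))

module _ (G H : Monomial → ℚ)
  (G-only-x₀ : ∀ i j → G (i ∷ suc j ∷ []) ≡ 0ℚ)
  (H-no-x₀ : ∀ i j → H (suc i ∷ j ∷ []) ≡ 0ℚ)
  where

  -- A term survives only if G receives no x₁ and H no x₀, which leaves x₀^m times x₁^n.
  convolution-separates : ∀ m n →
    Σℚ (factorisations (m ∷ n ∷ [])) (λ (β , γ) → G β * H γ) ≡ G (m ∷ 0 ∷ []) * H (0 ∷ n ∷ [])
  convolution-separates m n =
    Σℚ-single (factorisations-unique (m ∷ n ∷ [])) x₀^m∙x₁^n∈ vanish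
    where
    x₀^m∙x₁^n : Monomial × Monomial
    x₀^m∙x₁^n = m ∷ 0 ∷ [] , 0 ∷ n ∷ []

    x₀^m∙x₁^n∈ : x₀^m∙x₁^n ∈ factorisations (m ∷ n ∷ [])
    -- The enumeration lists the second exponent of x₀ as `m ∸ m`, which does not reduce to 0 for a
    -- variable m.
    x₀^m∙x₁^n∈ = subst (λ i → (m ∷ 0 ∷ [] , i ∷ n ∷ []) ∈ factorisations (m ∷ n ∷ [])) (ℕₚ.n∸n≡0 m)
      (∈-cartesianProductWith⁺ (factorise m) (∈-upTo⁺ (ℕₚ.n<1+n m)) (trivial∈factorisations (n ∷ [])))

    vanish : ∀ {x} → x ∈ factorisations (m ∷ n ∷ []) → x ≢ x₀^m∙x₁^n → G (proj₁ x) * H (proj₂ x) ≡ 0ℚ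
    vanish x∈ x≢ with ∈-cartesianProductWith⁻ (factorise m) (upTo (suc m)) (factorisations (n ∷ [])) x∈
    ... | i , _ , i∈ , x∈′ , refl
      with ∈-cartesianProductWith⁻ (factorise n) (upTo (suc n)) (factorisations []) x∈′
    ... | j , _ , _ , here refl , refl with m ∸ i in m∸i≡
    ... | suc l = trans (cong (G (i ∷ j ∷ []) *_) (H-no-x₀ l (n ∸ j))) (ℚₚ.*-zeroʳ (G (i ∷ j ∷ [])))
    ... | zero with ℕₚ.≤-antisym (ℕ.s≤s⁻¹ (∈-upTo⁻ i∈)) (ℕₚ.m∸n≡0⇒m≤n m∸i≡) | j
    ... | refl | zero  = ⊥-elim (x≢ refl)
    ... | refl | suc j = trans (cong (_* H (0 ∷ n ∸ suc j ∷ [])) (G-only-x₀ i j)) (ℚₚ.*-zeroˡ (H (0 ∷ n ∸ suc j ∷ [])))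

module _ {d : ℕ} (a : Poly d) where

  seq-F : ∀ m n k → seq (F a (m ∷ n ∷ [])) k ≡ seq (coeff a m) k * seq (coeff a n) k
  seq-F m n k = begin
    seq (F a (m ∷ n ∷ [])) k                  ≡⟨ seq-*ₛ (oneₛ *ₛ at a 0) (at a 1) (m ∷ n ∷ []) k ⟩
    _                                         ≡⟨ convolution-separates P₁ (λ γ → seq (at a 1 γ) k)
                                                   (λ i j → oneₛ-identityˡ (at a 0) (i ∷ suc j ∷ []) k)
                                                   (λ _ _ → refl) m n ⟩
    P₁ (m ∷ 0 ∷ []) * seq (coeff a n) k       ≡⟨ cong (_* seq (coeff a n) k) (oneₛ-identityˡ (at a 0) (m ∷ 0 ∷ []) k) ⟩
    seq (coeff a m) k * seq (coeff a n) k     ∎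
    where
    open ≡-Reasoning

    P₁ : Monomial → ℚ
    P₁ β = seq ((oneₛ *ₛ at a 0) β) k

-- Schur coefficients as determinants in the coefficients of P

module _ {d : ℕ} (a : Poly d) (c : List ℕ → ℝ) (expansion : IsSchurExpansion (F a) c) where

  schurSum : ℕ → ℕ → ℕ → ℝ
  schurSum N m n = Σᵣ (partitions N) λ ν → c ν *ᵣ schur ν (m ∷ n ∷ [])

  seq-schurSum : ∀ N m n k →
    seq (schurSum N m n) k ≡ Σℚ (partitions N) λ ν → seq (c ν) k * (ℤ.+ kostka ν m n ℚ./ 1)
  seq-schurSum N m n k = seq-Σᵣ (partitions N) (λ ν → c ν *ᵣ schur ν (m ∷ n ∷ [])) k

  -- The form `m + (n + 0)` is what the degree of the two-element monomial unfolds to.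
  F≈schurSum : ∀ N m n → m ℕ.+ (n ℕ.+ 0) ≡ N → F a (m ∷ n ∷ []) ≈ᵣ schurSum N m n
  F≈schurSum N m n deg≡N =
    subst (λ b → (if b then F a (m ∷ n ∷ []) else 0ℝ) ≈ᵣ schurSum N m n)
      (dec-true (degree (m ∷ n ∷ []) ℕₚ.≟ N) deg≡N) (expansion N (m ∷ n ∷ []))

  seq-⊗-F : ∀ m n → coeff a m ⊗ coeff a n ≗ᵣ F a (m ∷ n ∷ [])
  seq-⊗-F m n k = trans (seq-⊗ (coeff a m) (coeff a n) k) (sym (seq-F a m n k))

  -- The expansion gives equality only as `≈ᵣ`, not term by term, so it is used as two opposite
  -- inequalities.
  product≼schurSum : ∀ N m n → m ℕ.+ (n ℕ.+ 0) ≡ N → coeff a m ⊗ coeff a n ≼ schurSum N m n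
  product≼schurSum N m n deg≡N = begin
    coeff a m ⊗ coeff a n   ∼⟨ ≗⇒≼ (seq-⊗-F m n) ⟩
    F a (m ∷ n ∷ [])        ∼⟨ ≈⇒≼ (F a (m ∷ n ∷ [])) (schurSum N m n) (F≈schurSum N m n deg≡N) ⟩
    schurSum N m n          ∎
    where open ≼-Reasoning

  schurSum≼product : ∀ N m n → m ℕ.+ (n ℕ.+ 0) ≡ N → schurSum N m n ≼ coeff a m ⊗ coeff a n
  schurSum≼product N m n deg≡N = begin
    schurSum N m n          ∼⟨ ≈⇒≼ (schurSum N m n) (F a (m ∷ n ∷ []))
                                 (≈-sym (F a (m ∷ n ∷ [])) (schurSum N m n) (F≈schurSum N m n deg≡N)) ⟩
    F a (m ∷ n ∷ [])        ∼⟨ ≗⇒≼ (λ k → sym (seq-⊗-F m n k)) ⟩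
    coeff a m ⊗ coeff a n   ∎
    where open ≼-Reasoning

  c*1 : ∀ ν {K} k → K ≡ 1 → seq (c ν) k * (ℤ.+ K ℚ./ 1) ≡ seq (c ν) k
  c*1 ν k refl = ℚₚ.*-identityʳ (seq (c ν) k)

  c*0 : ∀ ν {K} k → K ≡ 0 → seq (c ν) k * (ℤ.+ K ℚ./ 1) ≡ 0ℚ
  c*0 ν k refl = ℚₚ.*-zeroʳ (seq (c ν) k)

  schurSum-row : ∀ m → schurSum m m 0 ≗ᵣ c (rowPartition m)
  schurSum-row m k = trans (seq-schurSum m m 0 k) (trans
    (Σℚ-single (partitions-unique m) (row∈ m)
      (λ {ν} ν∈ ν≢ → let ν-partition , sum≡m = ∈-partitions⁻ {m} ν∈ in
        c*0 ν k (kostka-row-zero ν-partition sum≡m ν≢)))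
    (c*1 (rowPartition m) k (kostka-row m)))
    where
    row∈ : ∀ m → rowPartition m ∈ partitions m
    row∈ zero    = here refl
    row∈ (suc m) = subst (λ N → suc m ∷ [] ∈ partitions N) (ℕₚ.+-identityʳ (suc m))
      (∈-partitions⁺ ([-] , s≤s z≤n ∷ []))

  -- By `kostka-shift` both sums agree off (m, n+1); that partition counts once for x₀^m x₁^(n+1)
  -- and not at all for x₀^(m+1) x₁^n.
  schurSum-shift : ∀ m n → n ℕ.< m → let N = m ℕ.+ (suc n ℕ.+ 0) in
    schurSum N m (suc n) ≗ᵣ schurSum N (suc m) n +ᵣ c (m ∷ suc n ∷ [])
  schurSum-shift m n n<m k = trans (seq-schurSum N m (suc n) k) (trans
    (Σℚ-differ (partitions-unique N) (∈-partitions⁺ t-partition)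
      (λ {ν} ν∈ ν≢ → let ν-partition , sum≡N = ∈-partitions⁻ {N} ν∈ in
        cong (λ K → seq (c ν) k * (ℤ.+ K ℚ./ 1))
          (kostka-shift n<m ν-partition (trans sum≡N N≡m+1+n) ν≢))
      (c*0 t k (kostka-two-rows-zero {m} (suc m) n (ℕₚ.n<1+n n))))
    (cong₂ _+_ (sym (seq-schurSum N (suc m) n k))
      (c*1 t k (kostka-two-rows {m} m (suc n) refl n<m ℕₚ.≤-refl))))
    where
    N : ℕ
    N = m ℕ.+ (suc n ℕ.+ 0)

    N≡m+1+n : N ≡ m ℕ.+ suc n
    N≡m+1+n = cong (m ℕ.+_) (ℕₚ.+-identityʳ (suc n))

    t : List ℕ
    t = m ∷ suc n ∷ []

    t-partition : IsPartition t
    t-partition = n<m ∷ [-] , ℕₚ.≤-trans (s≤s z≤n) n<m ∷ s≤s z≤n ∷ []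

  0≼c-row : ∀ m → 0ℝ ≼ coeff a m ⊗ coeff a 0 → 0ℝ ≼ c (rowPartition m)
  0≼c-row m 0≼aₘa₀ =
    ≼-trans 0≼aₘa₀ (≼-trans (product≼schurSum m m 0 (ℕₚ.+-identityʳ m)) (≗⇒≼ (schurSum-row m)))

  module _ (m n : ℕ) (n<m : n ℕ.< m) where

    private
      N : ℕ
      N = m ℕ.+ (suc n ℕ.+ 0)

      1+m+n≡N : suc m ℕ.+ (n ℕ.+ 0) ≡ N
      1+m+n≡N = sym (ℕₚ.+-suc m (n ℕ.+ 0))

    open ≼-Reasoning

    -- The minor is a_m a_(n+1) - a_(m+1) a_n, the Jacobi-Trudi determinant of (m, n+1) with a_k in
    -- place of h_k.
    0≼c⇒minor : 0ℝ ≼ c (m ∷ suc n ∷ []) → coeff a (suc m) ⊗ coeff a n ≼ coeff a m ⊗ coeff a (suc n)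
    0≼c⇒minor 0≼c = begin
      coeff a (suc m) ⊗ coeff a n                     ∼⟨ product≼schurSum N (suc m) n 1+m+n≡N ⟩
      schurSum N (suc m) n                            ∼⟨ 0≼y⇒x≼x+y 0≼c ⟩
      schurSum N (suc m) n +ᵣ c (m ∷ suc n ∷ [])      ∼⟨ ≗⇒≼ (λ k → sym (schurSum-shift m n n<m k)) ⟩
      schurSum N m (suc n)                            ∼⟨ schurSum≼product N m (suc n) refl ⟩
      coeff a m ⊗ coeff a (suc n)                     ∎

    minor⇒0≼c : coeff a (suc m) ⊗ coeff a n ≼ coeff a m ⊗ coeff a (suc n) → 0ℝ ≼ c (m ∷ suc n ∷ [])
    minor⇒0≼c minor = x≼x+y⇒0≼y (begin
      schurSum N (suc m) n                            ∼⟨ schurSum≼product N (suc m) n 1+m+n≡N ⟩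
      coeff a (suc m) ⊗ coeff a n                     ∼⟨ minor ⟩
      coeff a m ⊗ coeff a (suc n)                     ∼⟨ product≼schurSum N m (suc n) refl ⟩
      schurSum N m (suc n)                            ∼⟨ ≗⇒≼ (schurSum-shift m n n<m) ⟩
      schurSum N (suc m) n +ᵣ c (m ∷ suc n ∷ [])      ∎)

theorem1p3 : (d : ℕ) (a : Poly d) → a zero ≈ᵣ 1ℝ → (∀ j → 0ℝ <ᵣ a j) →
    (c : List ℕ → ℝ) → IsSchurExpansion (F a) c →
    let i   = ∀ ν → IsPartition ν → length ν ≤ 2 → 0ℝ ≤ᵣ c ν
        ii  = ∀ k → 1 ≤ k → 0ℝ ≤ᵣ c (k ∷ k ∷ [])
        iii = LogConcave a
        iv  = StronglyLogConcave a
    in (i ⇔ ii) × (ii ⇔ iii) × (iii ⇔ iv)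
theorem1p3 d a _ a-pos c expansion =
    -- The cycle i, ii, iii, i supplies the converses.
    mk⇔ i⇒ii (iii⇒i ∘ ii⇒iii)
  , mk⇔ ii⇒iii (i⇒ii ∘ iii⇒i)
  , mk⇔ (logConcave⇒stronglyLogConcave a a-pos) (stronglyLogConcave⇒logConcave a)
  where
  i⇒ii : (∀ ν → IsPartition ν → length ν ≤ 2 → 0ℝ ≤ᵣ c ν) → ∀ k → 1 ≤ k → 0ℝ ≤ᵣ c (k ∷ k ∷ [])
  i⇒ii c-nonNeg k 1≤k =
    c-nonNeg (k ∷ k ∷ []) (ℕₚ.≤-refl ∷ [-] , 1≤k ∷ 1≤k ∷ []) ℕₚ.≤-refl

  ii⇒iii : (∀ k → 1 ≤ k → 0ℝ ≤ᵣ c (k ∷ k ∷ [])) → LogConcave a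
  ii⇒iii c-nonNeg i j k j≡1+i k≡1+j = to-≤ᵣ (subst₂ _≼_
    (coeff-⊗ a i k refl (sym k≡1+j)) (coeff-⊗ a j j refl (sym j≡1+i))
    (≼-trans (≗⇒≼ (⊗-comm (coeff a (Fin.toℕ i)) (coeff a (suc (Fin.toℕ j)))))
    -- With m = j and n = j - 1 the partition (m, n+1) is (j, j), and the minor is a_j² - a_(j+1)
    -- a_(j-1).
    (0≼c⇒minor a c expansion (Fin.toℕ j) (Fin.toℕ i) (ℕₚ.≤-reflexive (sym j≡1+i))
      (from-≤ᵣ (subst (λ l → 0ℝ ≤ᵣ c (Fin.toℕ j ∷ l ∷ [])) j≡1+i
        (c-nonNeg (Fin.toℕ j) (subst (1 ≤_) (sym j≡1+i) (s≤s z≤n))))))))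

  -- This coefficient equals a_m a_0, which has nonnegative factors.
  c-row-nonNeg : ∀ m → 0ℝ ≼ c (rowPartition m)
  c-row-nonNeg m = 0≼c-row a c expansion m (nonNeg⇒≽0
    (⊗-nonNeg (coeff a m) (coeff a 0) (coeff-nonNeg a a-pos m) (coeff-nonNeg a a-pos 0)))

  iii⇒i : LogConcave a → ∀ ν → IsPartition ν → length ν ≤ 2 → 0ℝ ≤ᵣ c ν
  iii⇒i _  []                 _                           _ = to-≤ᵣ (c-row-nonNeg 0)
  iii⇒i _  (zero ∷ [])        (_ , () ∷ _)                _
  iii⇒i _  (suc m ∷ [])       _                           _ = to-≤ᵣ (c-row-nonNeg (suc m))
  iii⇒i _  (m ∷ zero ∷ [])    (_ , _ ∷ () ∷ _)            _
  iii⇒i lc (m ∷ suc n ∷ [])   (n<m ∷ _ , _)               _ = to-≤ᵣ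
    (minor⇒0≼c a c expansion m n n<m (coeff-inwards a a-pos lc n m (ℕₚ.<⇒≤ n<m)))
  iii⇒i _  (_ ∷ _ ∷ _ ∷ _)    _                           (s≤s (s≤s ()))
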